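{- For all constants $\alpha\ge1$ and $\beta\ge1$, there is a restricted-assignment instance with a nonempty bounded uncertainty set $\mathcal U$ (and a predicted scenario $\hat q\in\mathcal U$) such that no randomized algorithm is both $\alpha$-consistent and $\beta$-robust on it; that is, there is no random schedule $\mathcal S$ with $$\mathbb E[C_{\max}(\mathcal S,\hat q)]\le\alpha\,\mathrm{OPT}(\hat q)\quad\text{and}\quad \mathbb E[C_{\max}(\mathcal S,q)]\le\beta\,\mathrm{OPT}^{\mathrm{rob}}(\mathcal U)\ \text{ for all } q\in\mathcal U.$$
   Context: There are $m$ machines and $n$ jobs. Restricted assignment: each job $j$ has a nonempty eligibility set $M_j\subseteq[m]$, fixed across scenarios; a scenario $q$ is given by a vector of job sizes $p(q)\in\mathbb R_{\ge0}^n$, with processing times $q_{i,j}=p(q)_j$ if $i\in M_j$ and $q_{i,j}=\infty$ otherwise. An uncertainty set $\mathcal U$ is an arbitrary set of such scenarios; nonempty and bounded refers to the set of size vectors in $\mathbb R_{\ge0}^n$. A schedule is a partition $\mathcal S=(S_1,\dots,S_m)$ of $[n]$ (parts may be empty), and $C_{\max}(\mathcal S,q)=\max_{i}\sum_{j\in S_i}q_{i,j}$. $\mathrm{OPT}(q)=\min_{\mathcal S}C_{\max}(\mathcal S,q)$ and $\mathrm{OPT}^{\mathrm{rob}}(\mathcal U)=\min_{\mathcal S}\sup_{q\in\mathcal U}C_{\max}(\mathcal S,q)$, minima over deterministic schedules. A randomized algorithm returns, on input $(\mathcal U,\hat q)$, a random schedule; its consistency and robustness are measured in expectation, with the scenario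 $q$ chosen independently of the algorithm's randomness. -}

module Defs where

open import Data.Bool.Base using (if_then_else_)
open import Data.Fin.Base using (Fin; finToFun)
import Data.Fin.Properties as Fin
open import Data.Fin.Subset using (Subset; Nonempty)
open import Data.Fin.Subset.Properties using (_∈?_)
open import Data.Nat.Base as ℕ using (ℕ)
import Data.Nat.Properties as ℕ
open import Data.Product.Base using (∃-syntax; _×_; _,_)
open import Data.Rational.Base as ℚ using (ℚ; 0ℚ; 1ℚ; ½)
import Data.Rational.Properties as ℚ
open import Data.Rational.Solver using (module +-*-Solver)
open import Data.Sum.Base using (inj₁; inj₂)
open import Data.Vec.Functional using (Vector; foldr)
open import Level using (0ℓ)
open import Relation.Binary.PropositionalEquality using (_≡_; refl; sym; subst; cong; cong₂)
open import Relation.Nullary.Construct.Add.Supremum using (_⁺; [_]; ⊤⁺)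
open import Relation.Nullary.Decidable.Core using (does)
open import Relation.Unary using (Pred; _∈_; Satisfiable)
import Relation.Binary.Construct.Add.Supremum.Equality as Equality⁺
import Relation.Binary.Construct.Add.Supremum.NonStrict as NonStrict⁺

------------------------------------------------------------------------
-- Real numbers: Cauchy sequences of rationals, compared up to _≈_

IsCauchy : (ℕ → ℚ) → Set
IsCauchy s = ∀ ε → 0ℚ ℚ.< ε →
  ∃[ N ] (∀ k l → N ℕ.≤ k → N ℕ.≤ l → ℚ.∣ s k ℚ.- s l ∣ ℚ.≤ ε)

record ℝ : Set where
  constructor mkℝ
  field
    seq    : ℕ → ℚ
    cauchy : IsCauchy seq

open ℝ public

infix 4 _≈_ _≤_

record _≈_ (x y : ℝ) : Set where
  constructor mk≈
  field
    close : ∀ ε → 0ℚ ℚ.< ε →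
      ∃[ N ] (∀ k → N ℕ.≤ k → ℚ.∣ seq x k ℚ.- seq y k ∣ ℚ.≤ ε)

record _≤_ (x y : ℝ) : Set where
  constructor mk≤
  field
    bound : ∀ ε → 0ℚ ℚ.< ε →
      ∃[ N ] (∀ k → N ℕ.≤ k → seq x k ℚ.≤ seq y k ℚ.+ ε)

module CauchyClosure where
  private
    open ℚ.≤-Reasoning
    open +-*-Solver using (solve; _:=_; _:+_; _:-_; _:*_; :-_; con)

  p≤∣p∣ : ∀ p → p ℚ.≤ ℚ.∣ p ∣
  p≤∣p∣ p with ℚ.≤-total 0ℚ p
  ... | inj₁ 0≤p = ℚ.≤-reflexive (sym (ℚ.0≤p⇒∣p∣≡p 0≤p))
  ... | inj₂ p≤0 = ℚ.≤-trans p≤0 (ℚ.0≤∣p∣ p)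

  ∣p-q∣≡∣q-p∣ : ∀ p q → ℚ.∣ p ℚ.- q ∣ ≡ ℚ.∣ q ℚ.- p ∣
  ∣p-q∣≡∣q-p∣ p q = begin-equality
    ℚ.∣ p ℚ.- q ∣         ≡⟨ ℚ.∣-p∣≡∣p∣ (p ℚ.- q) ⟨
    ℚ.∣ ℚ.- (p ℚ.- q) ∣
      ≡⟨ cong ℚ.∣_∣ (solve 2 (λ p q → :- (p :- q) := q :- p) refl p q) ⟩
    ℚ.∣ q ℚ.- p ∣         ∎
  p≤q+ε : ∀ p q {ε} → ℚ.∣ p ℚ.- q ∣ ℚ.≤ ε → p ℚ.≤ q ℚ.+ ε
  p≤q+ε p q {ε} h = begin
    p                       ≡⟨ solve 2 (λ p q → p := q :+ (p :- q)) refl p q ⟩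
    q ℚ.+ (p ℚ.- q)         ≤⟨ ℚ.+-monoʳ-≤ q (p≤∣p∣ (p ℚ.- q)) ⟩
    q ℚ.+ ℚ.∣ p ℚ.- q ∣     ≤⟨ ℚ.+-monoʳ-≤ q h ⟩
    q ℚ.+ ε                 ∎

  q≤p+ε : ∀ p q {ε} → ℚ.∣ p ℚ.- q ∣ ℚ.≤ ε → q ℚ.≤ p ℚ.+ ε
  q≤p+ε p q h = p≤q+ε q p (subst (ℚ._≤ _) (∣p-q∣≡∣q-p∣ p q) h)

  p-q≤ε : ∀ p q {ε} → p ℚ.≤ q ℚ.+ ε → p ℚ.- q ℚ.≤ ε
  p-q≤ε p q {ε} h = begin
    p ℚ.- q            ≤⟨ ℚ.+-monoˡ-≤ (ℚ.- q) h ⟩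
    q ℚ.+ ε ℚ.- q      ≡⟨ solve 2 (λ q ε → q :+ ε :- q := ε) refl q ε ⟩
    ε                  ∎

  ∣p-q∣≤ε : ∀ p q {ε} → p ℚ.≤ q ℚ.+ ε → q ℚ.≤ p ℚ.+ ε → ℚ.∣ p ℚ.- q ∣ ℚ.≤ ε
  ∣p-q∣≤ε p q p≤ q≤ with ℚ.∣p∣≡p∨∣p∣≡-p (p ℚ.- q)
  ... | inj₁ eq = subst (ℚ._≤ _) (sym eq) (p-q≤ε p q p≤)
  ... | inj₂ eq = subst (ℚ._≤ _) (sym eq) (subst (ℚ._≤ _)
    (solve 2 (λ p q → q :- p := :- (p :- q)) refl p q) (p-q≤ε q p q≤))

  -- B * (ε / 2B) + (ε / 2B) * B = ε
  module Split (B ε : ℚ) (0<B : 0ℚ ℚ.< B) (0<ε : 0ℚ ℚ.< ε) where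
    instance
      B-positive : ℚ.Positive B
      B-positive = ℚ.positive 0<B

      B-nonZero : ℚ.NonZero B
      B-nonZero = ℚ.pos⇒nonZero B

      ε-positive : ℚ.Positive ε
      ε-positive = ℚ.positive 0<ε

      1/B-positive : ℚ.Positive (ℚ.1/ B)
      1/B-positive = ℚ.1/pos⇒pos B

      ½ε-positive : ℚ.Positive (½ ℚ.* ε)
      ½ε-positive = ℚ.pos*pos⇒pos ½ ε

    δ : ℚ
    δ = ½ ℚ.* ε ℚ.* ℚ.1/ B

    0<δ : 0ℚ ℚ.< δ
    0<δ = ℚ.positive⁻¹ δ {{ℚ.pos*pos⇒pos (½ ℚ.* ε) (ℚ.1/ B)}}

    Bδ+δB≡ε : B ℚ.* δ ℚ.+ δ ℚ.* B ≡ ε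
    Bδ+δB≡ε = begin-equality
      B ℚ.* δ ℚ.+ δ ℚ.* B
        ≡⟨ solve 3 (λ B ε i →
             B :* (con ½ :* ε :* i) :+ (con ½ :* ε :* i) :* B := ε :* (B :* i))
             refl B ε (ℚ.1/ B) ⟩
      ε ℚ.* (B ℚ.* ℚ.1/ B)   ≡⟨ cong (ε ℚ.*_) (ℚ.*-inverseʳ B) ⟩
      ε ℚ.* 1ℚ               ≡⟨ ℚ.*-identityʳ ε ⟩
      ε                      ∎

  0<1 : 0ℚ ℚ.< 1ℚ
  0<1 = ℚ.positive⁻¹ 1ℚ

  -- Abstract, so that normalising a real does not unfold these proofs.
  abstract
    +-cauchy : ∀ s t → IsCauchy s → IsCauchy t → IsCauchy (λ k → s k ℚ.+ t k)
    +-cauchy s t s-cauchy t-cauchy ε 0<ε =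
      let open Split 1ℚ ε 0<1 0<ε
          M , hM = s-cauchy δ 0<δ
          N , hN = t-cauchy δ 0<δ
      in M ℕ.⊔ N , λ k l k≥ l≥ → begin
        ℚ.∣ (s k ℚ.+ t k) ℚ.- (s l ℚ.+ t l) ∣
          ≡⟨ cong ℚ.∣_∣ (solve 4 (λ a b c d → (a :+ b) :- (c :+ d) := (a :- c) :+ (b :- d))
               refl (s k) (t k) (s l) (t l)) ⟩
        ℚ.∣ (s k ℚ.- s l) ℚ.+ (t k ℚ.- t l) ∣
          ≤⟨ ℚ.∣p+q∣≤∣p∣+∣q∣ (s k ℚ.- s l) (t k ℚ.- t l) ⟩
        ℚ.∣ s k ℚ.- s l ∣ ℚ.+ ℚ.∣ t k ℚ.- t l ∣
          ≤⟨ ℚ.+-mono-≤ (hM k l (ℕ.m⊔n≤o⇒m≤o M N k≥) (ℕ.m⊔n≤o⇒m≤o M N l≥))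
                        (hN k l (ℕ.m⊔n≤o⇒n≤o M N k≥) (ℕ.m⊔n≤o⇒n≤o M N l≥)) ⟩
        δ ℚ.+ δ
          ≡⟨ cong₂ ℚ._+_ (sym (ℚ.*-identityˡ δ)) (sym (ℚ.*-identityʳ δ)) ⟩
        1ℚ ℚ.* δ ℚ.+ δ ℚ.* 1ℚ
          ≡⟨ Bδ+δB≡ε ⟩
        ε ∎

    eventually-bounded : ∀ s → IsCauchy s →
      ∃[ b ] 0ℚ ℚ.< b × ∃[ N ] (∀ k → N ℕ.≤ k → ℚ.∣ s k ∣ ℚ.≤ b)
    eventually-bounded s s-cauchy =
      let N , h = s-cauchy 1ℚ 0<1
      in ℚ.∣ s N ∣ ℚ.+ 1ℚ
       , ℚ.+-mono-≤-< (ℚ.0≤∣p∣ (s N)) 0<1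
       , N
       , λ k k≥ → begin
           ℚ.∣ s k ∣
             ≡⟨ cong ℚ.∣_∣ (solve 2 (λ a b → a := b :+ (a :- b)) refl (s k) (s N)) ⟩
           ℚ.∣ s N ℚ.+ (s k ℚ.- s N) ∣
             ≤⟨ ℚ.∣p+q∣≤∣p∣+∣q∣ (s N) (s k ℚ.- s N) ⟩
           ℚ.∣ s N ∣ ℚ.+ ℚ.∣ s k ℚ.- s N ∣
             ≤⟨ ℚ.+-monoʳ-≤ ℚ.∣ s N ∣ (h k N k≥ ℕ.≤-refl) ⟩
           ℚ.∣ s N ∣ ℚ.+ 1ℚ ∎

    ∣*∣-mono : ∀ p q a b → ℚ.∣ p ∣ ℚ.≤ a → ℚ.∣ q ∣ ℚ.≤ b → 0ℚ ℚ.≤ a →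
               ℚ.∣ p ℚ.* q ∣ ℚ.≤ a ℚ.* b
    ∣*∣-mono p q a b p≤ q≤ 0≤a = begin
      ℚ.∣ p ℚ.* q ∣
        ≡⟨ ℚ.∣p*q∣≡∣p∣*∣q∣ p q ⟩
      ℚ.∣ p ∣ ℚ.* ℚ.∣ q ∣
        ≤⟨ ℚ.*-monoʳ-≤-nonNeg ℚ.∣ q ∣ {{ℚ.∣-∣-nonNeg q}} p≤ ⟩
      a ℚ.* ℚ.∣ q ∣
        ≤⟨ ℚ.*-monoˡ-≤-nonNeg a {{ℚ.nonNegative 0≤a}} q≤ ⟩
      a ℚ.* b ∎

    *-cauchy : ∀ s t → IsCauchy s → IsCauchy t → IsCauchy (λ k → s k ℚ.* t k)
    *-cauchy s t s-cauchy t-cauchy ε 0<ε =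
      let a , 0<a , K , hK = eventually-bounded s s-cauchy
          b , 0<b , L , hL = eventually-bounded t t-cauchy
          B = a ℚ.⊔ b
          0<B = ℚ.<-≤-trans 0<a (ℚ.p≤p⊔q a b)
          open Split B ε 0<B 0<ε
          M , hM = s-cauchy δ 0<δ
          N , hN = t-cauchy δ 0<δ
      in (K ℕ.⊔ L) ℕ.⊔ (M ℕ.⊔ N) , λ k l k≥ l≥ →
        let K≤k = ℕ.m⊔n≤o⇒m≤o K L (ℕ.m⊔n≤o⇒m≤o (K ℕ.⊔ L) (M ℕ.⊔ N) k≥)
            L≤l = ℕ.m⊔n≤o⇒n≤o K L (ℕ.m⊔n≤o⇒m≤o (K ℕ.⊔ L) (M ℕ.⊔ N) l≥)
            MN≤k = ℕ.m⊔n≤o⇒n≤o (K ℕ.⊔ L) (M ℕ.⊔ N) k≥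
            MN≤l = ℕ.m⊔n≤o⇒n≤o (K ℕ.⊔ L) (M ℕ.⊔ N) l≥
            s≤B = ℚ.≤-trans (hK k K≤k) (ℚ.p≤p⊔q a b)
            t≤B = ℚ.≤-trans (hL l L≤l) (ℚ.p≤q⊔p a b)
            s≤δ = hM k l (ℕ.m⊔n≤o⇒m≤o M N MN≤k) (ℕ.m⊔n≤o⇒m≤o M N MN≤l)
            t≤δ = hN k l (ℕ.m⊔n≤o⇒n≤o M N MN≤k) (ℕ.m⊔n≤o⇒n≤o M N MN≤l)
        in begin
        ℚ.∣ s k ℚ.* t k ℚ.- s l ℚ.* t l ∣
          ≡⟨ cong ℚ.∣_∣ (solve 4 (λ a b c d → a :* b :- c :* d := a :* (b :- d) :+ (a :- c) :* d)
               refl (s k) (t k) (s l) (t l)) ⟩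
        ℚ.∣ s k ℚ.* (t k ℚ.- t l) ℚ.+ (s k ℚ.- s l) ℚ.* t l ∣
          ≤⟨ ℚ.∣p+q∣≤∣p∣+∣q∣ (s k ℚ.* (t k ℚ.- t l)) ((s k ℚ.- s l) ℚ.* t l) ⟩
        ℚ.∣ s k ℚ.* (t k ℚ.- t l) ∣ ℚ.+ ℚ.∣ (s k ℚ.- s l) ℚ.* t l ∣
          ≤⟨ ℚ.+-mono-≤ 
               (∣*∣-mono (s k) (t k ℚ.- t l) B δ s≤B t≤δ (ℚ.<⇒≤ 0<B))
               (∣*∣-mono (s k ℚ.- s l) (t l) δ B s≤δ t≤B (ℚ.<⇒≤ 0<δ)) ⟩
        B ℚ.* δ ℚ.+ δ ℚ.* B
          ≡⟨ Bδ+δB≡ε ⟩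
        ε ∎

    ⊔-close : ∀ p q p′ q′ {ε} → p ℚ.≤ p′ ℚ.+ ε → q ℚ.≤ q′ ℚ.+ ε →
              p ℚ.⊔ q ℚ.≤ p′ ℚ.⊔ q′ ℚ.+ ε
    ⊔-close p q p′ q′ {ε} hp hq = ℚ.⊔-lub
      (ℚ.≤-trans hp (ℚ.+-monoˡ-≤ ε (ℚ.p≤p⊔q p′ q′)))
      (ℚ.≤-trans hq (ℚ.+-monoˡ-≤ ε (ℚ.p≤q⊔p p′ q′)))

    ⊓-close : ∀ p q p′ q′ {ε} → p ℚ.≤ p′ ℚ.+ ε → q ℚ.≤ q′ ℚ.+ ε →
              p ℚ.⊓ q ℚ.≤ p′ ℚ.⊓ q′ ℚ.+ ε
    ⊓-close p q p′ q′ {ε} hp hq with ℚ.⊓-sel p′ q′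
    ... | inj₁ eq = subst (λ a → _ ℚ.≤ a ℚ.+ ε) (sym eq) (ℚ.≤-trans (ℚ.p⊓q≤p p q) hp)
    ... | inj₂ eq = subst (λ a → _ ℚ.≤ a ℚ.+ ε) (sym eq) (ℚ.≤-trans (ℚ.p⊓q≤q p q) hq)

    lattice-cauchy : (_∙_ : ℚ → ℚ → ℚ) →
      (∀ p q p′ q′ {ε} → p ℚ.≤ p′ ℚ.+ ε → q ℚ.≤ q′ ℚ.+ ε → (p ∙ q) ℚ.≤ (p′ ∙ q′) ℚ.+ ε) →
      ∀ s t → IsCauchy s → IsCauchy t → IsCauchy (λ k → s k ∙ t k)
    lattice-cauchy _∙_ close s t s-cauchy t-cauchy ε 0<ε =
      let M , hM = s-cauchy ε 0<ε
          N , hN = t-cauchy ε 0<ε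
      in M ℕ.⊔ N , λ k l k≥ l≥ →
        let hs = hM k l (ℕ.m⊔n≤o⇒m≤o M N k≥) (ℕ.m⊔n≤o⇒m≤o M N l≥)
            ht = hN k l (ℕ.m⊔n≤o⇒n≤o M N k≥) (ℕ.m⊔n≤o⇒n≤o M N l≥)
        in ∣p-q∣≤ε (s k ∙ t k) (s l ∙ t l)
             (close (s k) (t k) (s l) (t l) (p≤q+ε (s k) (s l) hs) (p≤q+ε (t k) (t l) ht))
             (close (s l) (t l) (s k) (t k) (q≤p+ε (s k) (s l) hs) (q≤p+ε (t k) (t l) ht))

    const-cauchy : ∀ p → IsCauchy (λ _ → p)
    const-cauchy p ε 0<ε = 0 , λ _ _ _ _ → ∣p-q∣≤ε p p p≤p+ε p≤p+ε
      where
      p≤p+ε : p ℚ.≤ p ℚ.+ ε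
      p≤p+ε = subst (ℚ._≤ p ℚ.+ ε) (ℚ.+-identityʳ p) (ℚ.+-monoʳ-≤ p (ℚ.<⇒≤ 0<ε))

open CauchyClosure using
  (const-cauchy; +-cauchy; *-cauchy; lattice-cauchy; ⊔-close; ⊓-close)

infixl 6 _+_ _⊔_
infixl 7 _*_ _⊓_

fromℚ : ℚ → ℝ
fromℚ p = mkℝ (λ _ → p) (const-cauchy p)

0ℝ 1ℝ : ℝ
0ℝ = fromℚ 0ℚ
1ℝ = fromℚ 1ℚ

_+_ _*_ _⊔_ _⊓_ : ℝ → ℝ → ℝ
x + y = mkℝ (λ k → seq x k ℚ.+ seq y k) (+-cauchy (seq x) (seq y) (cauchy x) (cauchy y))
x * y = mkℝ (λ k → seq x k ℚ.* seq y k) (*-cauchy (seq x) (seq y) (cauchy x) (cauchy y))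
x ⊔ y = mkℝ (λ k → seq x k ℚ.⊔ seq y k)
  (lattice-cauchy ℚ._⊔_ ⊔-close (seq x) (seq y) (cauchy x) (cauchy y))
x ⊓ y = mkℝ (λ k → seq x k ℚ.⊓ seq y k)
  (lattice-cauchy ℚ._⊓_ ⊓-close (seq x) (seq y) (cauchy x) (cauchy y))

∑ : ∀ {n} → Vector ℝ n → ℝ
∑ = foldr _+_ 0ℝ

------------------------------------------------------------------------
-- Extended reals ℝ ∪ {∞}

ℝ∞ : Set
ℝ∞ = ℝ ⁺

∞ : ℝ∞
∞ = ⊤⁺

open Equality⁺ _≈_ public using () renaming (_≈⁺_ to _≈∞_)
open NonStrict⁺ _≤_ public using () renaming (_≤⁺_ to _≤∞_)

infixl 6 _+∞_ _⊔∞_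
infixl 7 _·∞_ _⊓∞_

_+∞_ _⊔∞_ _⊓∞_ : ℝ∞ → ℝ∞ → ℝ∞
[ x ] +∞ [ y ] = [ x + y ]
[ x ] +∞ ⊤⁺    = ∞
⊤⁺    +∞ _     = ∞

[ x ] ⊔∞ [ y ] = [ x ⊔ y ]
[ x ] ⊔∞ ⊤⁺    = ∞
⊤⁺    ⊔∞ _     = ∞

[ x ] ⊓∞ [ y ] = [ x ⊓ y ]
[ x ] ⊓∞ ⊤⁺    = [ x ]
⊤⁺    ⊓∞ y     = y

-- Only used with a factor c ≥ 1, so c · ∞ = ∞.
_·∞_ : ℝ → ℝ∞ → ℝ∞
c ·∞ [ x ] = [ c * x ]
c ·∞ ⊤⁺    = ∞

∑∞ : ∀ {n} → Vector ℝ∞ n → ℝ∞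
∑∞ = foldr _+∞_ [ 0ℝ ]

-- For families of nonnegative values, which makes 0 a neutral start.
max∞ : ∀ {n} → Vector ℝ∞ n → ℝ∞
max∞ = foldr _⊔∞_ [ 0ℝ ]

min∞ : ∀ {n} → Vector ℝ∞ n → ℝ∞
min∞ = foldr _⊓∞_ ∞

-- The supremum need not be computable for an arbitrary set, so it is given
-- by its defining property.
IsSup : ∀ {A : Set} → Pred A 0ℓ → (A → ℝ∞) → ℝ∞ → Set
IsSup U f v = (∀ {a} → a ∈ U → f a ≤∞ v)
            × (∀ w → (∀ {a} → a ∈ U → f a ≤∞ w) → v ≤∞ w)

------------------------------------------------------------------------
-- Restricted assignment

record Instance : Set where
  field
    machines jobs     : ℕ
    eligible          : Vector (Subset machines) jobs
    eligible-nonempty : ∀ j → Nonempty (eligible j)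

module _ (I : Instance) where
  open Instance I

  Machine Job : Set
  Machine = Fin machines
  Job     = Fin jobs

  -- A scenario is determined by its vector of job sizes.
  Scenario : Set
  Scenario = Vector ℝ jobs

  processingTime : Scenario → Machine → Job → ℝ∞
  processingTime p i j = if does (i ∈? eligible j) then [ p j ] else ∞

  -- The partition (S₁, …, S_m) given by j ∈ Sᵢ iff S j ≡ i.
  Schedule : Set
  Schedule = Job → Machine

  load : Schedule → Scenario → Machine → ℝ∞
  load S p i = ∑∞ λ j →
    if does (S j Fin.≟ i) then processingTime p i j else [ 0ℝ ]

  Cmax : Schedule → Scenario → ℝ∞
  Cmax S p = max∞ (load S p)

  -- finToFun enumerates all machines ^ jobs schedules.
  minOverSchedules : (Schedule → ℝ∞) → ℝ∞
  minOverSchedules f = min∞ {machines ℕ.^ jobs} λ k → f (finToFun k)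

  OPT : Scenario → ℝ∞
  OPT p = minOverSchedules λ S → Cmax S p

  -- respects makes U a set of real vectors, not of representing sequences.
  record UncertaintySet : Set₁ where
    field
      U           : Pred Scenario 0ℓ
      respects    : ∀ {p q} → (∀ j → p j ≈ q j) → p ∈ U → q ∈ U
      nonnegative : ∀ {p} → p ∈ U → ∀ j → 0ℝ ≤ p j

  Bounded : Pred Scenario 0ℓ → Set
  Bounded U = ∃[ b ] (∀ {p} → p ∈ U → ∀ j → p j ≤ b)

  IsOPTrob : Pred Scenario 0ℓ → ℝ∞ → Set
  IsOPTrob U v = ∃[ worst ]
      (∀ S → IsSup U (Cmax S) (worst S))
    × v ≈∞ minOverSchedules worst

  -- A random variable on a finite probability space. There are finitely
  -- many schedules, so every distribution of a random schedule arises.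
  record RandomSchedule : Set where
    field
      outcomes    : ℕ
      prob        : Vector ℝ outcomes
      nonnegative : ∀ ω → 0ℝ ≤ prob ω
      total       : ∑ prob ≈ 1ℝ
      schedule    : Vector Schedule outcomes

  -- E[X] ≤ b for [0,∞]-valued X. E[X] is the supremum of the expectations
  -- of finite-valued minorants of X, so ∞ on a null outcome contributes 0
  -- and on a non-null outcome makes E[X] = ∞.
  ExpectationAtMost : (R : RandomSchedule) → (Schedule → ℝ∞) → ℝ∞ → Set
  ExpectationAtMost R X b = ∀ (f : Vector ℝ outcomes) →
    (∀ ω → [ f ω ] ≤∞ X (schedule ω)) →
    [ ∑ (λ ω → prob ω * f ω) ] ≤∞ b
    where open RandomSchedule R

  Consistent : ℝ → Scenario → RandomSchedule → Set
  Consistent α q̂ R = ExpectationAtMost R (λ S → Cmax S q̂) (α ·∞ OPT q̂)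

  -- The third argument is the value of OPT^rob(U).
  Robust : ℝ → Pred Scenario 0ℓ → ℝ∞ → RandomSchedule → Set
  Robust β U optrob R = ∀ {q} → q ∈ U →
    ExpectationAtMost R (λ S → Cmax S q) (β ·∞ optrob)

{-# OPTIONS --safe #-}
module Submission where

-- Jobs are the cells of a k × l grid; the job (r , c) may run on the row machine
-- R r or on the column machine C c.  Nominally every job has size 1, and in the
-- t-th adverse scenario the jobs of row t have size k and all others size 0.
-- Putting all jobs on rows gives OPT(q̂) ≤ l, putting all on columns gives
-- OPT^rob ≤ k.  For a random schedule, summing the consistency bound over the
-- column machines leaves at most α l² jobs on columns in expectation, while
-- summing the robustness bound over the adverse scenarios leaves at most β k on
-- rows.  All k l jobs lie somewhere, so k l ≤ α l² + β k, which fails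
-- once l ≥ β + 1 and k ≥ α l² + 1.

open import Defs
open import Data.Bool.Base using (if_then_else_)
open import Data.Fin.Base using (Fin; zero; suc; _↑ˡ_; _↑ʳ_; splitAt; combine; remQuot; finToFun; funToFin)
import Data.Fin.Properties as Fin
open import Data.Fin.Subset as Subset using (⁅_⁆; _∪_)
open import Data.Fin.Subset.Properties using (_∈?_; x∈⁅x⁆; x∈⁅y⁆⇒x≡y; x∈p∪q⁺; x∈p∪q⁻)
import Data.Integer.Base as ℤ
import Data.Integer.Properties as ℤ
open import Data.Nat.Base as ℕ using (ℕ; zero; suc)
import Data.Nat.Properties as ℕ
open import Data.Product.Base using (Σ-syntax; ∃-syntax; _×_; _,_; proj₁; proj₂)
open import Data.Rational.Base as ℚ using (ℚ; mkℚ; 0ℚ; 1ℚ; ½)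
import Data.Rational.Properties as ℚ
open import Data.Rational.Solver using (module +-*-Solver)
import Data.Rational.Unnormalised.Base as ℚᵘ
import Data.Rational.Unnormalised.Properties as ℚᵘ
open import Data.Sum.Base using (inj₁; inj₂)
open import Data.Vec.Functional using (Vector)
open import Algebra.Bundles using (module CommutativeRing)
open import Algebra.Properties.Semiring.Sum (CommutativeRing.semiring ℚ.+-*-commutativeRing)
  using (sum; sum-cong-≗; ∑-distrib-+; ∑-comm; *-distribˡ-sum; *-distribʳ-sum; sum-replicate-zero)
open import Function.Base using (_∘_; const)
open import Relation.Binary.PropositionalEquality
  using (_≡_; _≢_; _≗_; refl; sym; trans; cong; cong₂; subst; module ≡-Reasoning)
open import Relation.Nullary.Construct.Add.Supremum using ([_]; ⊤⁺)
open import Relation.Nullary.Decidable.Core using (does; yes; no)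
open import Relation.Nullary.Negation.Core using (¬_; contradiction)
open import Relation.Unary using (_∈_; Satisfiable)
open import Relation.Binary.Construct.Add.Supremum.Equality _≈_ using (≈⁺-refl)
open import Relation.Binary.Construct.Add.Supremum.NonStrict _≤_ using ([_]; _≤⊤⁺; ≤⁺-trans; [≤]-injective)

open +-*-Solver using (solve; _:=_; _:+_; _:-_; _:*_; con)

-- Sums of rationals

-- The embedding of the naturals, written as a sum of ones so that counting jobs is an instance of
-- `sum` and the sum lemmas apply to it directly.
⟦_⟧ : ℕ → ℚ
⟦ n ⟧ = sum {n} (const 1ℚ)

sum-const : ∀ n x → sum {n} (const x) ≡ ⟦ n ⟧ ℚ.* x
sum-const n x = sym (trans (*-distribʳ-sum x (const {B = Fin n} 1ℚ))
  (sum-cong-≗ {n} (λ _ → ℚ.*-identityˡ x)))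

-- Links the iterated sum to the fraction n/1, for which inequalities are cross-multiplications of
-- integers; this serves `archimedean`.
toℚᵘ-⟦⟧ : ∀ n → ℚ.toℚᵘ ⟦ n ⟧ ℚᵘ.≃ ℚᵘ.mkℚᵘ (ℤ.+ n) 0
toℚᵘ-⟦⟧ zero    = ℚᵘ.≃-refl
toℚᵘ-⟦⟧ (suc n) = ℚᵘ.≃-trans (ℚ.toℚᵘ-homo-+ 1ℚ ⟦ n ⟧)
  (ℚᵘ.≃-trans (ℚᵘ.+-congʳ (ℚ.toℚᵘ 1ℚ) (toℚᵘ-⟦⟧ n))
    (ℚᵘ.≃-reflexive (cong (λ m → ℚᵘ.mkℚᵘ (1ℤ+ m) 0) (ℤ.*-identityʳ (ℤ.+ n)))))
  where
  1ℤ+ : ℤ.ℤ → ℤ.ℤ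
  1ℤ+ m = ℤ.+ 1 ℤ.+ m

-- A nonnegative fraction is at most its numerator, the denominator being at least 1; a negative one
-- lies below 0.
archimedean : ∀ q → ∃[ n ] q ℚ.≤ ⟦ n ⟧
archimedean q@(mkℚ (ℤ.+ n) d-1 _) = n , ℚ.toℚᵘ-cancel-≤
  (ℚᵘ.≤-respʳ-≃ (ℚᵘ.≃-sym (toℚᵘ-⟦⟧ n))
    (ℚᵘ.*≤* (ℤ.*-monoˡ-≤-nonNeg (ℤ.+ n) (ℤ.+≤+ (ℕ.s≤s ℕ.z≤n)))))
archimedean (mkℚ ℤ.-[1+ n ] d-1 _) = 0 , ℚ.*≤* ℤ.-≤+

sum-+ : ∀ m {n} (f : Vector ℚ (m ℕ.+ n)) →
        sum f ≡ sum (λ i → f (i ↑ˡ n)) ℚ.+ sum (λ j → f (m ↑ʳ j))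
sum-+ zero    f = sym (ℚ.+-identityˡ (sum f))
sum-+ (suc m) f = trans (cong (f zero ℚ.+_) (sum-+ m (f ∘ suc)))
  (sym (ℚ.+-assoc (f zero) _ _))

sum-combine : ∀ m n (f : Vector ℚ (m ℕ.* n)) →
              sum f ≡ sum (λ (r : Fin m) → sum (λ (c : Fin n) → f (combine r c)))
sum-combine zero    n f = refl
sum-combine (suc m) n f = trans (sum-+ n f)
  (cong (sum (λ c → f (c ↑ˡ (m ℕ.* n))) ℚ.+_) (sum-combine m n (f ∘ (n ↑ʳ_))))

⟦⟧-* : ∀ m n → ⟦ m ℕ.* n ⟧ ≡ ⟦ m ⟧ ℚ.* ⟦ n ⟧
⟦⟧-* m n = trans (sum-combine m n (const 1ℚ)) (sum-const m ⟦ n ⟧)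

-- Kronecker deltas as rational indicators.

δ : ∀ {n} → Fin n → Fin n → ℚ
δ i j = if does (i Fin.≟ j) then 1ℚ else 0ℚ

δ-refl : ∀ {n} (i : Fin n) → δ i i ≡ 1ℚ
δ-refl i with i Fin.≟ i
... | yes _  = refl
... | no i≢i = contradiction refl i≢i

δ-≢ : ∀ {n} {i j : Fin n} → i ≢ j → δ i j ≡ 0ℚ
δ-≢ {i = i} {j} i≢j with i Fin.≟ j
... | yes i≡j = contradiction i≡j i≢j
... | no _    = refl

δ-injective : ∀ {m n} (f : Fin m → Fin n) → (∀ {i j} → f i ≡ f j → i ≡ j) →
              ∀ i j → δ (f i) (f j) ≡ δ i j
δ-injective f inj i j with i Fin.≟ j
... | yes refl = δ-refl (f i)
... | no i≢j   = δ-≢ (i≢j ∘ inj)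

0≤1 : 0ℚ ℚ.≤ 1ℚ
0≤1 = ℚ.nonNegative⁻¹ 1ℚ

0≤δ : ∀ {n} (i j : Fin n) → 0ℚ ℚ.≤ δ i j
0≤δ i j with i Fin.≟ j
... | yes _ = 0≤1
... | no _  = ℚ.≤-refl

δ≤1 : ∀ {n} (i j : Fin n) → δ i j ℚ.≤ 1ℚ
δ≤1 i j with i Fin.≟ j
... | yes _ = ℚ.≤-refl
... | no _  = 0≤1

δ*δ : ∀ {n} (i j : Fin n) → δ i j ℚ.* δ i j ≡ δ i j
δ*δ i j with i Fin.≟ j
... | yes _ = refl
... | no _  = refl

sum-δʳ : ∀ {n} (i : Fin n) → sum (δ i) ≡ 1ℚ
sum-δʳ {suc n} zero    = cong (1ℚ ℚ.+_) (sum-replicate-zero n)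
sum-δʳ {suc n} (suc i) = cong (0ℚ ℚ.+_) (sum-δʳ i)

sum-δˡ : ∀ {n} (j : Fin n) → sum (λ i → δ i j) ≡ 1ℚ
sum-δˡ {suc n} zero    = cong (1ℚ ℚ.+_) (sum-replicate-zero n)
sum-δˡ {suc n} (suc j) = cong (0ℚ ℚ.+_) (sum-δˡ j)

-- The fibres of `g` partition the indices, so each `x j` is counted once, at `i = g j`. It is used
-- with `g` the row or the column of a job.
sum-δ-* : ∀ {m n} (g : Fin n → Fin m) (x : Vector ℚ n) →
          sum (λ i → sum (λ j → δ (g j) i ℚ.* x j)) ≡ sum x
sum-δ-* g x = begin
  sum (λ i → sum (λ j → δ (g j) i ℚ.* x j))   ≡⟨ ∑-comm (λ i j → δ (g j) i ℚ.* x j) ⟩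
  sum (λ j → sum (λ i → δ (g j) i ℚ.* x j))
    ≡⟨ sum-cong-≗ (λ j → *-distribʳ-sum (x j) (δ (g j))) ⟨
  sum (λ j → sum (δ (g j)) ℚ.* x j)
    ≡⟨ sum-cong-≗ (λ j → trans (cong (ℚ._* x j) (sum-δʳ (g j))) (ℚ.*-identityˡ (x j))) ⟩
  sum x                                        ∎
  where open ≡-Reasoning

0≤* : ∀ {p q} → 0ℚ ℚ.≤ p → 0ℚ ℚ.≤ q → 0ℚ ℚ.≤ p ℚ.* q
0≤* {p} {q} 0≤p 0≤q = subst (ℚ._≤ p ℚ.* q) (ℚ.*-zeroʳ p)
  (ℚ.*-monoˡ-≤-nonNeg p {{ℚ.nonNegative 0≤p}} 0≤q)

0<* : ∀ {p q} → 0ℚ ℚ.< p → 0ℚ ℚ.< q → 0ℚ ℚ.< p ℚ.* q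
0<* {p} {q} 0<p 0<q = subst (ℚ._< p ℚ.* q) (ℚ.*-zeroʳ p)
  (ℚ.*-monoʳ-<-pos p {{ℚ.positive 0<p}} 0<q)

0≤⟦⟧ : ∀ n → 0ℚ ℚ.≤ ⟦ n ⟧
0≤⟦⟧ zero    = ℚ.≤-refl
0≤⟦⟧ (suc n) = ℚ.+-mono-≤ 0≤1 (0≤⟦⟧ n)

-- Order on the reals and the extended reals

Eventually : (ℕ → Set) → Set
Eventually P = ∃[ N ] (∀ k → N ℕ.≤ k → P k)

eventually-map₂ : ∀ {P Q R : ℕ → Set} → (∀ k → P k → Q k → R k) →
                  Eventually P → Eventually Q → Eventually R
eventually-map₂ f (M , p) (N , q) = M ℕ.⊔ N , λ k k≥ →
  f k (p k (ℕ.m⊔n≤o⇒m≤o M N k≥)) (q k (ℕ.m⊔n≤o⇒n≤o M N k≥))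

p≤p+ε : ∀ p {ε} → 0ℚ ℚ.< ε → p ℚ.≤ p ℚ.+ ε
p≤p+ε p {ε} 0<ε = subst (ℚ._≤ p ℚ.+ ε) (ℚ.+-identityʳ p) (ℚ.+-monoʳ-≤ p (ℚ.<⇒≤ 0<ε))

½ε+½ε≡ε : ∀ ε → ½ ℚ.* ε ℚ.+ ½ ℚ.* ε ≡ ε
½ε+½ε≡ε = solve 1 (λ ε → con ½ :* ε :+ con ½ :* ε := ε) refl

0<½ε : ∀ {ε} → 0ℚ ℚ.< ε → 0ℚ ℚ.< ½ ℚ.* ε
0<½ε {ε} 0<ε = subst (ℚ._< ½ ℚ.* ε) (ℚ.*-zeroʳ ½) (ℚ.*-monoʳ-<-pos ½ 0<ε)

pointwise-≤ : ∀ {x y} → (∀ k → seq x k ℚ.≤ seq y k) → x ≤ y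
pointwise-≤ {x} {y} h = mk≤ λ ε 0<ε → 0 , λ k _ →
  ℚ.≤-trans (h k) (p≤p+ε (seq y k) 0<ε)

≤-refl : ∀ {x} → x ≤ x
≤-refl = pointwise-≤ λ _ → ℚ.≤-refl

≤-trans : ∀ {x y z} → x ≤ y → y ≤ z → x ≤ z
≤-trans {x} {y} {z} (mk≤ x≤y) (mk≤ y≤z) = mk≤ λ ε 0<ε →
  eventually-map₂
    (λ k x≤ y≤ → begin
      seq x k                                   ≤⟨ x≤ ⟩
      seq y k ℚ.+ ½ ℚ.* ε                       ≤⟨ ℚ.+-monoˡ-≤ (½ ℚ.* ε) y≤ ⟩
      seq z k ℚ.+ ½ ℚ.* ε ℚ.+ ½ ℚ.* ε           ≡⟨ ℚ.+-assoc (seq z k) _ _ ⟩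
      seq z k ℚ.+ (½ ℚ.* ε ℚ.+ ½ ℚ.* ε)         ≡⟨ cong (seq z k ℚ.+_) (½ε+½ε≡ε ε) ⟩
      seq z k ℚ.+ ε                             ∎)
    (x≤y _ (0<½ε 0<ε)) (y≤z _ (0<½ε 0<ε))
  where open ℚ.≤-Reasoning

≈⇒≥ : ∀ {x y} → x ≈ y → y ≤ x
≈⇒≥ {x} {y} (mk≈ x≈y) = mk≤ λ ε 0<ε →
  let N , h = x≈y ε 0<ε
  in N , λ k k≥ → CauchyClosure.q≤p+ε (seq x k) (seq y k) (h k k≥)

≈⇒≤ : ∀ {x y} → x ≈ y → x ≤ y
≈⇒≤ {x} {y} (mk≈ x≈y) = mk≤ λ ε 0<ε →
  let N , h = x≈y ε 0<ε
  in N , λ k k≥ → CauchyClosure.p≤q+ε (seq x k) (seq y k) (h k k≥)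

≈-refl : ∀ {x} → x ≈ x
≈-refl {x} = mk≈ λ ε 0<ε → 0 , λ k _ →
  CauchyClosure.∣p-q∣≤ε (seq x k) (seq x k) (p≤p+ε (seq x k) 0<ε) (p≤p+ε (seq x k) 0<ε)

+-mono-≤ : ∀ {x y u v} → x ≤ y → u ≤ v → x + u ≤ y + v
+-mono-≤ {x} {y} {u} {v} (mk≤ x≤y) (mk≤ u≤v) = mk≤ λ ε 0<ε →
  eventually-map₂
    (λ k x≤ u≤ → begin
      seq x k ℚ.+ seq u k                               ≤⟨ ℚ.+-mono-≤ x≤ u≤ ⟩
      (seq y k ℚ.+ ½ ℚ.* ε) ℚ.+ (seq v k ℚ.+ ½ ℚ.* ε)
        ≡⟨ solve 3 (λ y v ε → (y :+ con ½ :* ε) :+ (v :+ con ½ :* ε) := y :+ v :+ ε)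
             refl (seq y k) (seq v k) ε ⟩
      seq y k ℚ.+ seq v k ℚ.+ ε                         ∎)
    (x≤y _ (0<½ε 0<ε)) (u≤v _ (0<½ε 0<ε))
  where open ℚ.≤-Reasoning

⊔-lub : ∀ {x y z} → x ≤ z → y ≤ z → x ⊔ y ≤ z
⊔-lub (mk≤ x≤z) (mk≤ y≤z) = mk≤ λ ε 0<ε →
  eventually-map₂ (λ k → ℚ.⊔-lub) (x≤z ε 0<ε) (y≤z ε 0<ε)

fromℚ-mono : ∀ {p q} → p ℚ.≤ q → fromℚ p ≤ fromℚ q
fromℚ-mono p≤q = pointwise-≤ λ _ → p≤q

fromℚ-cancel : ∀ {p q} → fromℚ p ≤ fromℚ q → p ℚ.≤ q
fromℚ-cancel {p} {q} (mk≤ h) = ℚ.≮⇒≥ λ q<p →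
  -- With `m` strictly between `q` and `p` and tolerance `m - q`, a single index of the constant
  -- sequences already gives `p ≤ m < p`.
  let m , q<m , m<p = ℚ.<-dense q<p
      0<ε : 0ℚ ℚ.< m ℚ.- q
      0<ε = subst (ℚ._< m ℚ.- q) (ℚ.+-inverseʳ q) (ℚ.+-monoˡ-< (ℚ.- q) q<m)
      N , p≤ = h (m ℚ.- q) 0<ε
      p≤m = subst (p ℚ.≤_) (solve 2 (λ q m → q :+ (m :- q) := m) refl q m) (p≤ N ℕ.≤-refl)
  in ℚ.<-irrefl refl (ℚ.<-≤-trans m<p p≤m)

≤∞-refl : ∀ {x} → x ≤∞ x
≤∞-refl {[ _ ]} = [ ≤-refl ]
≤∞-refl {⊤⁺}    = ⊤⁺ ≤⊤⁺

≤∞-reflexive : ∀ {x y} → x ≡ y → x ≤∞ y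
≤∞-reflexive refl = ≤∞-refl

≤∞-trans : ∀ {x y z} → x ≤∞ y → y ≤∞ z → x ≤∞ z
≤∞-trans = ≤⁺-trans ≤-trans

+∞-mono-≤ : ∀ {x y u v} → x ≤∞ y → u ≤∞ v → (x +∞ u) ≤∞ (y +∞ v)
+∞-mono-≤ [ x≤y ]   [ u≤v ]   = [ +-mono-≤ x≤y u≤v ]
+∞-mono-≤ [ _ ]     (_ ≤⊤⁺)   = _ ≤⊤⁺
+∞-mono-≤ (_ ≤⊤⁺)   _         = _ ≤⊤⁺

x≤x⊔∞y : ∀ x y → x ≤∞ (x ⊔∞ y)
x≤x⊔∞y [ x ] [ y ] = [ pointwise-≤ (λ k → ℚ.p≤p⊔q (seq x k) (seq y k)) ]
x≤x⊔∞y [ x ] ⊤⁺    = _ ≤⊤⁺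
x≤x⊔∞y ⊤⁺    y     = _ ≤⊤⁺

y≤x⊔∞y : ∀ x y → y ≤∞ (x ⊔∞ y)
y≤x⊔∞y [ x ] [ y ] = [ pointwise-≤ (λ k → ℚ.p≤q⊔p (seq x k) (seq y k)) ]
y≤x⊔∞y [ x ] ⊤⁺    = _ ≤⊤⁺
y≤x⊔∞y ⊤⁺    y     = _ ≤⊤⁺

⊔∞-lub : ∀ {x y z} → x ≤∞ z → y ≤∞ z → (x ⊔∞ y) ≤∞ z
⊔∞-lub [ x≤z ]   [ y≤z ] = [ ⊔-lub x≤z y≤z ]
⊔∞-lub (_ ≤⊤⁺)   _       = _ ≤⊤⁺

x⊓∞y≤x : ∀ x y → (x ⊓∞ y) ≤∞ x
x⊓∞y≤x [ x ] [ y ] = [ pointwise-≤ (λ k → ℚ.p⊓q≤p (seq x k) (seq y k)) ]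
x⊓∞y≤x [ x ] ⊤⁺    = ≤∞-refl
x⊓∞y≤x ⊤⁺    y     = _ ≤⊤⁺

x⊓∞y≤y : ∀ x y → (x ⊓∞ y) ≤∞ y
x⊓∞y≤y [ x ] [ y ] = [ pointwise-≤ (λ k → ℚ.p⊓q≤q (seq x k) (seq y k)) ]
x⊓∞y≤y [ x ] ⊤⁺    = _ ≤⊤⁺
x⊓∞y≤y ⊤⁺    y     = ≤∞-refl

v≤max∞ : ∀ {n} (v : Vector ℝ∞ n) i → v i ≤∞ max∞ v
v≤max∞ v zero    = x≤x⊔∞y (v zero) _
v≤max∞ v (suc i) = ≤∞-trans (v≤max∞ (v ∘ suc) i) (y≤x⊔∞y (v zero) _)

0≤max∞ : ∀ {n} (v : Vector ℝ∞ n) → [ 0ℝ ] ≤∞ max∞ v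
0≤max∞ {zero}  v = ≤∞-refl
0≤max∞ {suc n} v = ≤∞-trans (0≤max∞ (v ∘ suc)) (y≤x⊔∞y (v zero) _)

max∞-lub : ∀ {n} (v : Vector ℝ∞ n) {w} → [ 0ℝ ] ≤∞ w → (∀ i → v i ≤∞ w) → max∞ v ≤∞ w
max∞-lub {zero}  v 0≤w v≤w = 0≤w
max∞-lub {suc n} v 0≤w v≤w = ⊔∞-lub (v≤w zero) (max∞-lub (v ∘ suc) 0≤w (v≤w ∘ suc))

max∞-mono : ∀ {n} {v w : Vector ℝ∞ n} → (∀ i → v i ≤∞ w i) → max∞ v ≤∞ max∞ w
max∞-mono {v = v} {w} v≤w = max∞-lub v (0≤max∞ w) λ i → ≤∞-trans (v≤w i) (v≤max∞ w i)

min∞≤v : ∀ {n} (v : Vector ℝ∞ n) i → min∞ v ≤∞ v i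
min∞≤v v zero    = x⊓∞y≤x (v zero) _
min∞≤v v (suc i) = ≤∞-trans (x⊓∞y≤y (v zero) _) (min∞≤v (v ∘ suc) i)

∑∞-mono : ∀ {n} {v w : Vector ℝ∞ n} → (∀ i → v i ≤∞ w i) → ∑∞ v ≤∞ ∑∞ w
∑∞-mono {zero}  v≤w = ≤∞-refl
∑∞-mono {suc n} v≤w = +∞-mono-≤ (v≤w zero) (∑∞-mono (v≤w ∘ suc))

∑∞-∞ : ∀ {n} (v : Vector ℝ∞ n) i → v i ≡ ∞ → ∑∞ v ≡ ∞
∑∞-∞ v zero    eq rewrite eq = refl
∑∞-∞ v (suc i) eq rewrite ∑∞-∞ (v ∘ suc) i eq with v zero
... | [ _ ] = refl
... | ⊤⁺    = refl

∑∞-upper : ∀ {n} {v : Vector ℝ∞ n} (w : Vector ℚ n) →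
           (∀ i → v i ≤∞ [ fromℚ (w i) ]) → ∑∞ v ≤∞ [ fromℚ (sum w) ]
∑∞-upper {zero}  w v≤w = ≤∞-refl
∑∞-upper {suc n} w v≤w = ≤∞-trans
  (+∞-mono-≤ (v≤w zero) (∑∞-upper (w ∘ suc) (v≤w ∘ suc)))
  [ pointwise-≤ (λ _ → ℚ.≤-refl) ]

∑∞-lower : ∀ {n} {v : Vector ℝ∞ n} (w : Vector ℚ n) →
           (∀ i → [ fromℚ (w i) ] ≤∞ v i) → [ fromℚ (sum w) ] ≤∞ ∑∞ v
∑∞-lower {zero}  w w≤v = ≤∞-refl
∑∞-lower {suc n} w w≤v = ≤∞-trans
  [ pointwise-≤ (λ _ → ℚ.≤-refl) ]
  (+∞-mono-≤ (w≤v zero) (∑∞-lower (w ∘ suc) (w≤v ∘ suc)))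

-- α ≥ 1 enters only here: it makes the sequence of α eventually nonnegative.
·∞-upper : ∀ α {A c v} → 1ℝ ≤ α → 0ℚ ℚ.< A → Eventually (λ k → ℚ.∣ seq α k ∣ ℚ.≤ A) →
           0ℚ ℚ.≤ c → v ≤∞ [ fromℚ c ] → (α ·∞ v) ≤∞ [ fromℚ (A ℚ.* c) ]
·∞-upper α {A} {c} {[ x ]} (mk≤ 1≤α) 0<A α≤A 0≤c [ mk≤ x≤c ] = [ mk≤ bound ]
  where
  open ℚ.≤-Reasoning
  bound : ∀ ε → 0ℚ ℚ.< ε → Eventually (λ k → seq α k ℚ.* seq x k ℚ.≤ A ℚ.* c ℚ.+ ε)
  bound ε 0<ε = eventually-map₂
    (λ { k (1≤ , α≤) x≤ →
      let 0≤α : 0ℚ ℚ.≤ seq α k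
          0≤α = subst (0ℚ ℚ.≤_) (solve 1 (λ a → a :+ con 1ℚ :- con 1ℚ := a) refl (seq α k))
                  (ℚ.+-monoˡ-≤ (ℚ.- 1ℚ) 1≤)
      in begin
      seq α k ℚ.* seq x k         ≤⟨ ℚ.*-monoˡ-≤-nonNeg (seq α k) {{ℚ.nonNegative 0≤α}} x≤ ⟩
      seq α k ℚ.* (c ℚ.+ Sp.δ)
        ≤⟨ ℚ.*-monoʳ-≤-nonNeg (c ℚ.+ Sp.δ)
             {{ℚ.nonNegative (ℚ.+-mono-≤ 0≤c (ℚ.<⇒≤ Sp.0<δ))}}
             (ℚ.≤-trans (CauchyClosure.p≤∣p∣ (seq α k)) α≤) ⟩
      A ℚ.* (c ℚ.+ Sp.δ)          ≡⟨ ℚ.*-distribˡ-+ A c Sp.δ ⟩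
      A ℚ.* c ℚ.+ A ℚ.* Sp.δ      ≤⟨ ℚ.+-monoʳ-≤ (A ℚ.* c) Aδ≤ε ⟩
      A ℚ.* c ℚ.+ ε               ∎ })
    -- At tolerance 1 the hypothesis reads `1 ≤ seq α k + 1`, which is nonnegativity of `seq α k`.
    (eventually-map₂ (λ k → _,_) (1≤α 1ℚ CauchyClosure.0<1) α≤A)
    (x≤c Sp.δ Sp.0<δ)
    where
    module Sp = CauchyClosure.Split A ε 0<A 0<ε
    Aδ≤ε : A ℚ.* Sp.δ ℚ.≤ ε
    Aδ≤ε = begin
      A ℚ.* Sp.δ                        ≡⟨ ℚ.+-identityʳ _ ⟨
      A ℚ.* Sp.δ ℚ.+ 0ℚ
        ≤⟨ ℚ.+-monoʳ-≤ (A ℚ.* Sp.δ) (0≤* (ℚ.<⇒≤ Sp.0<δ) (ℚ.<⇒≤ 0<A)) ⟩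
      A ℚ.* Sp.δ ℚ.+ Sp.δ ℚ.* A         ≡⟨ Sp.Bδ+δB≡ε ⟩
      ε                                 ∎

-- Expectations of rational random variables

seq-∑ : ∀ {n} (v : Vector ℝ n) k → seq (∑ v) k ≡ sum (λ i → seq (v i) k)
seq-∑ {zero}  v k = refl
seq-∑ {suc n} v k = cong (seq (v zero) k ℚ.+_) (seq-∑ (v ∘ suc) k)

module _ {n} (prob : Vector ℝ n) where

  𝔼 : Vector ℚ n → ℝ
  𝔼 f = ∑ λ ω → prob ω * fromℚ (f ω)

  seq-𝔼 : ∀ f k → seq (𝔼 f) k ≡ sum (λ ω → seq (prob ω) k ℚ.* f ω)
  seq-𝔼 f = seq-∑ (λ ω → prob ω * fromℚ (f ω))

  -- The values of `f` and `g` are exact rationals and only the probabilities are approximated, so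
  -- linearity is distributivity at each index, with no tolerance.
  𝔼-+ : ∀ f g → 𝔼 (λ ω → f ω ℚ.+ g ω) ≤ 𝔼 f + 𝔼 g
  𝔼-+ f g = pointwise-≤ λ k → ℚ.≤-reflexive (begin
    seq (𝔼 (λ ω → f ω ℚ.+ g ω)) k
      ≡⟨ seq-𝔼 (λ ω → f ω ℚ.+ g ω) k ⟩
    sum (λ ω → seq (prob ω) k ℚ.* (f ω ℚ.+ g ω))
      ≡⟨ sum-cong-≗ (λ ω → ℚ.*-distribˡ-+ (seq (prob ω) k) (f ω) (g ω)) ⟩
    sum (λ ω → seq (prob ω) k ℚ.* f ω ℚ.+ seq (prob ω) k ℚ.* g ω)
      ≡⟨ ∑-distrib-+ (λ ω → seq (prob ω) k ℚ.* f ω) (λ ω → seq (prob ω) k ℚ.* g ω) ⟩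
    sum (λ ω → seq (prob ω) k ℚ.* f ω) ℚ.+ sum (λ ω → seq (prob ω) k ℚ.* g ω)
      ≡⟨ cong₂ ℚ._+_ (seq-𝔼 f k) (seq-𝔼 g k) ⟨
    seq (𝔼 f) k ℚ.+ seq (𝔼 g) k ∎)
    where open ≡-Reasoning

  𝔼-+-≤ : ∀ f g {a b} → 𝔼 f ≤ fromℚ a → 𝔼 g ≤ fromℚ b →
          𝔼 (λ ω → f ω ℚ.+ g ω) ≤ fromℚ (a ℚ.+ b)
  𝔼-+-≤ f g f≤a g≤b = ≤-trans (𝔼-+ f g)
    (≤-trans (+-mono-≤ f≤a g≤b) (pointwise-≤ λ _ → ℚ.≤-refl))

  𝔼-0 : 𝔼 (const 0ℚ) ≤ fromℚ 0ℚ
  𝔼-0 = pointwise-≤ λ k → ℚ.≤-reflexive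
    (trans (seq-𝔼 (const 0ℚ) k)
      (trans (sum-cong-≗ (λ ω → ℚ.*-zeroʳ (seq (prob ω) k))) (sum-replicate-zero n)))

  𝔼-sum-≤ : ∀ {m} (f : Fin m → Vector ℚ n) {b} → (∀ i → 𝔼 (f i) ≤ fromℚ b) →
            𝔼 (λ ω → sum (λ i → f i ω)) ≤ fromℚ (sum {m} (const b))
  𝔼-sum-≤ {zero}  f f≤b = 𝔼-0
  𝔼-sum-≤ {suc m} f f≤b = 𝔼-+-≤ (f zero) _ (f≤b zero) (𝔼-sum-≤ (f ∘ suc) (f≤b ∘ suc))

  -- This is where total probability 1 enters: multiplying `1 ≤ ∑ prob` by `a` bounds the
  -- expectation from below.
  𝔼-const : ∑ prob ≈ 1ℝ → ∀ {a} → 0ℚ ℚ.< a → ∀ f → (∀ ω → f ω ≡ a) → fromℚ a ≤ 𝔼 f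
  𝔼-const total {a} 0<a f f≡a = mk≤ λ ε 0<ε →
    let module Sp = CauchyClosure.Split a ε 0<a 0<ε
        -- The error in the total is scaled by `a`; the tolerance `δ + δ` is chosen so that the
        -- scaled error is exactly `ε`.
        N , h = _≤_.bound (≈⇒≥ total) (Sp.δ ℚ.+ Sp.δ) (ℚ.+-mono-< Sp.0<δ Sp.0<δ)
    in N , λ k k≥ → begin
      a                                               ≡⟨ ℚ.*-identityˡ a ⟨
      1ℚ ℚ.* a
        ≤⟨ ℚ.*-monoʳ-≤-nonNeg a {{ℚ.nonNegative (ℚ.<⇒≤ 0<a)}} (h k k≥) ⟩
      (seq (∑ prob) k ℚ.+ (Sp.δ ℚ.+ Sp.δ)) ℚ.* a
        ≡⟨ solve 3 (λ s d a → (s :+ (d :+ d)) :* a := s :* a :+ (a :* d :+ d :* a))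
             refl (seq (∑ prob) k) Sp.δ a ⟩
      seq (∑ prob) k ℚ.* a ℚ.+ (a ℚ.* Sp.δ ℚ.+ Sp.δ ℚ.* a)
        ≡⟨ cong₂ ℚ._+_ (total-f k) Sp.Bδ+δB≡ε ⟩
      seq (𝔼 f) k ℚ.+ ε                               ∎
    where
    open ℚ.≤-Reasoning
    total-f : ∀ k → seq (∑ prob) k ℚ.* a ≡ seq (𝔼 f) k
    total-f k = begin-equality
      seq (∑ prob) k ℚ.* a                 ≡⟨ cong (ℚ._* a) (seq-∑ prob k) ⟩
      sum (λ ω → seq (prob ω) k) ℚ.* a     ≡⟨ *-distribʳ-sum a (λ ω → seq (prob ω) k) ⟩
      sum (λ ω → seq (prob ω) k ℚ.* a)
        ≡⟨ sum-cong-≗ (λ ω → cong (seq (prob ω) k ℚ.*_) (f≡a ω)) ⟨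
      sum (λ ω → seq (prob ω) k ℚ.* f ω)   ≡⟨ seq-𝔼 f k ⟨
      seq (𝔼 f) k                          ∎

-- Makespans

module _ (I : Instance) where
  open Instance I

  loadTerm : Schedule I → Scenario I → Machine I → Job I → ℝ∞
  loadTerm S p i j = if does (S j Fin.≟ i) then processingTime I p i j else [ 0ℝ ]

  -- The rational value of `loadTerm` on an eligible assignment; the product form lets loads be
  -- computed by exchanging finite sums.
  share : Schedule I → Vector ℚ jobs → Machine I → Job I → ℚ
  share S s i j = δ (S j) i ℚ.* s j

  loadTerm-mono : ∀ S {p q} i j → p j ≤ q j → loadTerm S p i j ≤∞ loadTerm S q i j
  loadTerm-mono S i j p≤q with S j Fin.≟ i
  ... | no _ = ≤∞-refl
  ... | yes _ with i ∈? eligible j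
  ...   | yes _ = [ p≤q ]
  ...   | no _  = ≤∞-refl

  loadTerm-eligible : ∀ S s i j → S j Subset.∈ eligible j →
                      loadTerm S (fromℚ ∘ s) i j ≡ [ fromℚ (share S s i j) ]
  loadTerm-eligible S s i j Sj∈ with S j Fin.≟ i
  ... | no _ = cong (λ x → [ fromℚ x ]) (sym (ℚ.*-zeroˡ (s j)))
  ... | yes refl with S j ∈? eligible j
  ...   | yes _  = cong (λ x → [ fromℚ x ]) (sym (ℚ.*-identityˡ (s j)))
  ...   | no Sj∉ = contradiction Sj∈ Sj∉

  loadTerm-ineligible : ∀ S p j → ¬ S j Subset.∈ eligible j → loadTerm S p (S j) j ≡ ∞
  loadTerm-ineligible S p j Sj∉ with S j Fin.≟ S j
  ... | no S≢S = contradiction refl S≢S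
  ... | yes _ with S j ∈? eligible j
  ...   | yes Sj∈ = contradiction Sj∈ Sj∉
  ...   | no _    = refl

  Cmax-mono : ∀ S {p q} → (∀ j → p j ≤ q j) → Cmax I S p ≤∞ Cmax I S q
  Cmax-mono S {p} {q} p≤q =
    max∞-mono λ i → ∑∞-mono λ j → loadTerm-mono S {p} {q} i j (p≤q j)

  Cmax-cong : ∀ {S T} p → S ≗ T → Cmax I S p ≤∞ Cmax I T p
  Cmax-cong p S≗T = max∞-mono λ i → ∑∞-mono λ j → ≤∞-reflexive
    (cong (λ m → if does (m Fin.≟ i) then processingTime I p i j else [ 0ℝ ]) (S≗T j))

  Cmax-upper : ∀ S s {b} → (∀ j → S j Subset.∈ eligible j) → 0ℚ ℚ.≤ b →
               (∀ i → sum (share S s i) ℚ.≤ b) → Cmax I S (fromℚ ∘ s) ≤∞ [ fromℚ b ]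
  Cmax-upper S s S∈ 0≤b share≤b = max∞-lub (load I S (fromℚ ∘ s)) [ fromℚ-mono 0≤b ] λ i →
    ≤∞-trans
      (∑∞-upper (share S s i) λ j → ≤∞-reflexive (loadTerm-eligible S s i j (S∈ j)))
      [ fromℚ-mono (share≤b i) ]

  -- Only eligible assignments have to be bounded: any other makes the makespan ∞.
  Cmax-lower : ∀ S s i (w : Vector ℚ jobs) →
               (∀ j → S j Subset.∈ eligible j → w j ℚ.≤ share S s i j) →
               [ fromℚ (sum w) ] ≤∞ Cmax I S (fromℚ ∘ s)
  Cmax-lower S s i w w≤share with Fin.all? (λ j → S j ∈? eligible j)
  ... | yes S∈ = ≤∞-trans
    (∑∞-lower w λ j → subst ([ fromℚ (w j) ] ≤∞_)
      (sym (loadTerm-eligible S s i j (S∈ j))) [ fromℚ-mono (w≤share j (S∈ j)) ])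
    (v≤max∞ (load I S (fromℚ ∘ s)) i)
  ... | no S∉ =
    let j , Sj∉ = Fin.¬∀⟶∃¬ jobs (λ j → S j Subset.∈ eligible j) (λ j → S j ∈? eligible j) S∉
        load≡∞  = ∑∞-∞ (loadTerm S (fromℚ ∘ s) (S j)) j
                    (loadTerm-ineligible S (fromℚ ∘ s) j Sj∉)
    in ≤∞-trans (_ ≤⊤⁺)
         (≤∞-trans (≤∞-reflexive (sym load≡∞)) (v≤max∞ (load I S (fromℚ ∘ s)) (S j)))

  -- The enumeration contains `S` at index `funToFin S`, but only up to pointwise equality, hence
  -- the condition that `f` respects `≗`.
  minOverSchedules-≤ : ∀ {f} → (∀ {S T} → S ≗ T → f S ≤∞ f T) →
                       ∀ S → minOverSchedules I f ≤∞ f S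
  minOverSchedules-≤ {f} f-cong S = ≤∞-trans
    (min∞≤v {machines ℕ.^ jobs} (λ k → f (finToFun k)) (funToFin S))
    (f-cong (Fin.finToFun-funToFin S))

  -- Uncertainty sets generated by finitely many size vectors.

  module _ {n} (size : Fin (suc n) → Vector ℚ jobs) where

    -- The downward closure of the given vectors respects equality of reals, and by monotonicity of
    -- the makespan its suprema are maxima over the generators.
    dominated : UncertaintySet I
    dominated = record
      { U           = λ p → (∀ j → 0ℝ ≤ p j) × ∃[ t ] (∀ j → p j ≤ fromℚ (size t j))
      ; respects    = λ p≈q (0≤p , t , p≤) →
          (λ j → ≤-trans (0≤p j) (≈⇒≤ (p≈q j))) , t , λ j → ≤-trans (≈⇒≥ (p≈q j)) (p≤ j)
      ; nonnegative = proj₁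
      }

    worst : Schedule I → ℝ∞
    worst S = max∞ λ t → Cmax I S (fromℚ ∘ size t)

    worst-cong : ∀ {S T} → S ≗ T → worst S ≤∞ worst T
    worst-cong S≗T = max∞-mono λ t → Cmax-cong (fromℚ ∘ size t) S≗T

    size∈dominated : (∀ t j → 0ℚ ℚ.≤ size t j) → ∀ t → (fromℚ ∘ size t) ∈ UncertaintySet.U dominated
    size∈dominated 0≤size t = (λ j → fromℚ-mono (0≤size t j)) , t , λ j → ≤-refl

    worst-isSup : (∀ t j → 0ℚ ℚ.≤ size t j) →
                  ∀ S → IsSup (UncertaintySet.U dominated) (Cmax I S) (worst S)
    worst-isSup 0≤size S =
        (λ {p} (_ , t , p≤) → ≤∞-trans (Cmax-mono S {p} p≤)
          (v≤max∞ (λ t → Cmax I S (fromℚ ∘ size t)) t))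
      , λ w h → max∞-lub (λ t → Cmax I S (fromℚ ∘ size t))
          -- As `max∞` starts from 0, the bound `0 ≤ w` is due too; it comes from the nonnegative
          -- makespan of the generator `size zero`.
          (≤∞-trans (0≤max∞ (load I S (fromℚ ∘ size zero))) (h (size∈dominated 0≤size zero)))
          (λ t → h (size∈dominated 0≤size t))

-- The grid instance

module Grid (k l : ℕ) where

  R : Fin k → Fin (k ℕ.+ l)
  R r = r ↑ˡ l

  C : Fin l → Fin (k ℕ.+ l)
  C c = k ↑ʳ c

  row : Fin (k ℕ.* l) → Fin k
  row j = proj₁ (remQuot l j)

  col : Fin (k ℕ.* l) → Fin l
  col j = proj₂ (remQuot {k} l j)

  grid : Instance
  grid = record
    { machines          = k ℕ.+ l
    ; jobs              = k ℕ.* l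
    ; eligible          = λ j → ⁅ R (row j) ⁆ ∪ ⁅ C (col j) ⁆
    ; eligible-nonempty = λ j → R (row j) , x∈p∪q⁺ (inj₁ (x∈⁅x⁆ (R (row j))))
    }

  open Instance grid using (eligible)

  R≢C : ∀ {r c} → R r ≢ C c
  R≢C {r} {c} eq with trans (sym (Fin.splitAt-↑ˡ k r l))
                        (trans (cong (splitAt k) eq) (Fin.splitAt-↑ʳ k l c))
  ... | ()

  δ-RR : ∀ r r′ → δ (R r) (R r′) ≡ δ r r′
  δ-RR = δ-injective R (Fin.↑ˡ-injective l _ _)

  δ-CC : ∀ c c′ → δ (C c) (C c′) ≡ δ c c′
  δ-CC = δ-injective C (Fin.↑ʳ-injective k _ _)

  δ-RC : ∀ r c → δ (R r) (C c) ≡ 0ℚ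
  δ-RC r c = δ-≢ (R≢C {r} {c})

  δ-CR : ∀ c r → δ (C c) (R r) ≡ 0ℚ
  δ-CR c r = δ-≢ (R≢C {r} {c} ∘ sym)

  machine-elim : (P : Fin (k ℕ.+ l) → Set) → (∀ r → P (R r)) → (∀ c → P (C c)) → ∀ i → P i
  machine-elim P pR pC i with splitAt k i | Fin.join-splitAt k l i
  ... | inj₁ r | eq = subst P eq (pR r)
  ... | inj₂ c | eq = subst P eq (pC c)

  eligible-elim : ∀ {j i} (P : Fin (k ℕ.+ l) → Set) → P (R (row j)) → P (C (col j)) →
                  i Subset.∈ eligible j → P i
  eligible-elim {j} P pR pC i∈ with x∈p∪q⁻ ⁅ R (row j) ⁆ ⁅ C (col j) ⁆ i∈
  ... | inj₁ i∈R = subst P (sym (x∈⁅y⁆⇒x≡y (R (row j)) i∈R)) pR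
  ... | inj₂ i∈C = subst P (sym (x∈⁅y⁆⇒x≡y (C (col j)) i∈C)) pC

  sum-grid : (h : Fin k → Fin l → ℚ) →
             sum (λ j → h (row j) (col j)) ≡ sum (λ r → sum (h r))
  sum-grid h = trans (sum-combine k l (λ j → h (row j) (col j)))
    (sum-cong-≗ λ r → sum-cong-≗ λ c →
      cong (λ rc → h (proj₁ rc) (proj₂ rc)) (Fin.remQuot-combine r c))

  -- Index `zero` is the nominal scenario, index `suc t` the one adverse to row `t`.
  size : Fin (suc k) → Fin (k ℕ.* l) → ℚ
  size zero    j = 1ℚ
  size (suc t) j = ⟦ k ⟧ ℚ.* δ (row j) t

  0≤size : ∀ t j → 0ℚ ℚ.≤ size t j
  0≤size zero    j = 0≤1
  0≤size (suc t) j = 0≤* (0≤⟦⟧ k) (0≤δ (row j) t)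

  size≤ : 1ℚ ℚ.≤ ⟦ k ⟧ → ∀ t j → size t j ℚ.≤ ⟦ k ⟧
  size≤ 1≤k zero    j = 1≤k
  size≤ 1≤k (suc t) j = subst (size (suc t) j ℚ.≤_) (ℚ.*-identityʳ ⟦ k ⟧)
    (ℚ.*-monoˡ-≤-nonNeg ⟦ k ⟧ {{ℚ.nonNegative (0≤⟦⟧ k)}} (δ≤1 (row j) t))

  -- Upper bounds on the nominal and the robust optimum.

  -- The witness puts every job on its row machine: `l` unit jobs on each row machine and none on
  -- the columns.
  OPT-nominal : OPT grid (fromℚ ∘ size zero) ≤∞ [ fromℚ ⟦ l ⟧ ]
  OPT-nominal = ≤∞-trans
    (minOverSchedules-≤ grid (λ {S} {T} → Cmax-cong grid {S} {T} (fromℚ ∘ size zero)) (R ∘ row))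
    (Cmax-upper grid (R ∘ row) (size zero) (λ j → x∈p∪q⁺ (inj₁ (x∈⁅x⁆ (R (row j))))) (0≤⟦⟧ l)
      (machine-elim (λ i → sum (share grid (R ∘ row) (size zero) i) ℚ.≤ ⟦ l ⟧)
        (λ r → ℚ.≤-reflexive (on-row r)) (λ c → ℚ.≤-trans (ℚ.≤-reflexive (on-col c)) (0≤⟦⟧ l))))
    where
    open ≡-Reasoning
    on-row : ∀ r → sum (share grid (R ∘ row) (size zero) (R r)) ≡ ⟦ l ⟧
    on-row r = begin
      sum (λ j → δ (R (row j)) (R r) ℚ.* 1ℚ)
        ≡⟨ sum-cong-≗ (λ j → trans (ℚ.*-identityʳ _) (δ-RR (row j) r)) ⟩
      sum (λ j → δ (row j) r)                                ≡⟨ sum-grid (λ r′ c → δ r′ r) ⟩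
      sum (λ r′ → sum {l} (λ c → δ r′ r))                    ≡⟨ ∑-comm (λ r′ (c : Fin l) → δ r′ r) ⟩
      sum {l} (λ c → sum (λ r′ → δ r′ r))
        ≡⟨ sum-cong-≗ {l} (λ c → sum-δˡ r) ⟩
      ⟦ l ⟧                                                  ∎
    on-col : ∀ c → sum (share grid (R ∘ row) (size zero) (C c)) ≡ 0ℚ
    on-col c = trans
      (sum-cong-≗ (λ j → cong (ℚ._* 1ℚ) (δ-RC (row j) c)))
      (sum-replicate-zero (k ℕ.* l))

  OPTrob : ℝ∞
  OPTrob = minOverSchedules grid (worst grid size)

  -- The witness puts every job on its column machine, which then holds one job of each row: `k`
  -- unit jobs nominally, and a single nonzero job, of size `k`, in an adverse scenario.
  OPTrob-upper : OPTrob ≤∞ [ fromℚ ⟦ k ⟧ ]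
  OPTrob-upper = ≤∞-trans
    (minOverSchedules-≤ grid (λ {S} {T} → worst-cong grid size {S} {T}) (C ∘ col))
    (max∞-lub (λ t → Cmax grid (C ∘ col) (fromℚ ∘ size t)) [ fromℚ-mono (0≤⟦⟧ k) ] λ t →
      Cmax-upper grid (C ∘ col) (size t) (λ j → x∈p∪q⁺ (inj₂ (x∈⁅x⁆ (C (col j))))) (0≤⟦⟧ k)
        (machine-elim (λ i → sum (share grid (C ∘ col) (size t) i) ℚ.≤ ⟦ k ⟧)
          (λ r → ℚ.≤-trans (ℚ.≤-reflexive (on-row t r)) (0≤⟦⟧ k))
          (λ c → ℚ.≤-reflexive (on-col t c))))
    where
    open ≡-Reasoning
    on-row : ∀ t r → sum (share grid (C ∘ col) (size t) (R r)) ≡ 0ℚ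
    on-row t r = trans
      (sum-cong-≗ (λ j → trans (cong (ℚ._* size t j) (δ-CR (col j) r)) (ℚ.*-zeroˡ (size t j))))
      (sum-replicate-zero (k ℕ.* l))
    -- Sizes depend on the row alone, so every column carries the same load.
    entry : Fin (suc k) → Fin k → ℚ
    entry zero    r = 1ℚ
    entry (suc t) r = ⟦ k ⟧ ℚ.* δ r t
    size-row : ∀ t j → size t j ≡ entry t (row j)
    size-row zero    j = refl
    size-row (suc t) j = refl
    sum-entry : ∀ t → sum (entry t) ≡ ⟦ k ⟧
    sum-entry zero    = refl
    sum-entry (suc t) = trans (sym (*-distribˡ-sum ⟦ k ⟧ (λ r → δ r t)))
      (trans (cong (⟦ k ⟧ ℚ.*_) (sum-δˡ t)) (ℚ.*-identityʳ ⟦ k ⟧))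
    on-col : ∀ t c → sum (share grid (C ∘ col) (size t) (C c)) ≡ ⟦ k ⟧
    on-col t c = begin
      sum (λ j → δ (C (col j)) (C c) ℚ.* size t j)
        ≡⟨ sum-cong-≗ (λ j → cong₂ ℚ._*_ (δ-CC (col j) c) (size-row t j)) ⟩
      sum (λ j → δ (col j) c ℚ.* entry t (row j))
        ≡⟨ sum-grid (λ r c′ → δ c′ c ℚ.* entry t r) ⟩
      sum (λ r → sum (λ c′ → δ c′ c ℚ.* entry t r))
        ≡⟨ sum-cong-≗ (λ r → *-distribʳ-sum (entry t r) (λ c′ → δ c′ c)) ⟨
      sum (λ r → sum (λ c′ → δ c′ c) ℚ.* entry t r)
        ≡⟨ sum-cong-≗ (λ r → trans (cong (ℚ._* entry t r) (sum-δˡ c)) (ℚ.*-identityˡ (entry t r))) ⟩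
      sum (entry t)
        ≡⟨ sum-entry t ⟩
      ⟦ k ⟧ ∎

  -- Costs that charge each job to its row or its column.

  -- For a schedule using eligible machines only, 1 − atRow S j is the share of j
  -- on its column machine.
  atRow : Schedule grid → Fin (k ℕ.* l) → ℚ
  atRow S j = δ (S j) (R (row j))

  -- A finite minorant of the nominal makespan, as `ExpectationAtMost` asks for. Using `1 - atRow`
  -- makes the costs add up to a constant even for schedules with ineligible assignments.
  colCost : Fin l → Schedule grid → ℚ
  colCost c S = sum λ j → δ (col j) c ℚ.* (1ℚ ℚ.- atRow S j)

  rowCost : Fin k → Schedule grid → ℚ
  rowCost r S = sum λ j → δ (row j) r ℚ.* (⟦ k ⟧ ℚ.* atRow S j)

  -- A job of column `c` that is off its row machine can eligibly run only on `C c`, where it adds 1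
  -- to the load.
  colCost≤Cmax : ∀ c S → [ fromℚ (colCost c S) ] ≤∞ Cmax grid S (fromℚ ∘ size zero)
  colCost≤Cmax c S = Cmax-lower grid S (size zero) (C c) _ λ j → eligible-elim
    (λ i → δ (col j) c ℚ.* (1ℚ ℚ.- δ i (R (row j))) ℚ.≤ δ i (C c) ℚ.* 1ℚ)
    (begin
      δ (col j) c ℚ.* (1ℚ ℚ.- δ (R (row j)) (R (row j)))
        ≡⟨ cong (λ x → δ (col j) c ℚ.* (1ℚ ℚ.- x)) (δ-refl (R (row j))) ⟩
      δ (col j) c ℚ.* 0ℚ                  ≡⟨ ℚ.*-zeroʳ (δ (col j) c) ⟩
      0ℚ                                  ≤⟨ 0≤* (0≤δ (R (row j)) (C c)) 0≤1 ⟩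
      δ (R (row j)) (C c) ℚ.* 1ℚ          ∎)
    (begin
      δ (col j) c ℚ.* (1ℚ ℚ.- δ (C (col j)) (R (row j)))
        ≡⟨ cong₂ (λ x y → x ℚ.* (1ℚ ℚ.- y)) (sym (δ-CC (col j) c)) (δ-CR (col j) (row j)) ⟩
      δ (C (col j)) (C c) ℚ.* 1ℚ          ∎)
    where open ℚ.≤-Reasoning

  -- Each job of row `r` placed on `R r` adds `k` to that load in the scenario adverse to row `r`.
  rowCost≤Cmax : ∀ r S → [ fromℚ (rowCost r S) ] ≤∞ Cmax grid S (fromℚ ∘ size (suc r))
  rowCost≤Cmax r S = Cmax-lower grid S (size (suc r)) (R r) _ λ j → eligible-elim
    (λ i → δ (row j) r ℚ.* (⟦ k ⟧ ℚ.* δ i (R (row j))) ℚ.≤ δ i (R r) ℚ.* size (suc r) j)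
    (begin
      δ (row j) r ℚ.* (⟦ k ⟧ ℚ.* δ (R (row j)) (R (row j)))
        -- Idempotence duplicates the indicator of row `r`: one copy places the job on `R r`, the
        -- other gives it size `k`.
        ≡⟨ cong₂ (λ d x → d ℚ.* (⟦ k ⟧ ℚ.* x)) (sym (δ*δ (row j) r)) (δ-refl (R (row j))) ⟩
      (δ (row j) r ℚ.* δ (row j) r) ℚ.* (⟦ k ⟧ ℚ.* 1ℚ)
        ≡⟨ solve 2 (λ d κ → (d :* d) :* (κ :* con 1ℚ) := d :* (κ :* d)) refl (δ (row j) r) ⟦ k ⟧ ⟩
      δ (row j) r ℚ.* (⟦ k ⟧ ℚ.* δ (row j) r)
        ≡⟨ cong (ℚ._* (⟦ k ⟧ ℚ.* δ (row j) r)) (δ-RR (row j) r) ⟨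
      δ (R (row j)) (R r) ℚ.* (⟦ k ⟧ ℚ.* δ (row j) r) ∎)
    (begin
      δ (row j) r ℚ.* (⟦ k ⟧ ℚ.* δ (C (col j)) (R (row j)))
        ≡⟨ cong (λ x → δ (row j) r ℚ.* (⟦ k ⟧ ℚ.* x)) (δ-CR (col j) (row j)) ⟩
      δ (row j) r ℚ.* (⟦ k ⟧ ℚ.* 0ℚ)
        ≡⟨ solve 2 (λ d κ → d :* (κ :* con 0ℚ) := con 0ℚ) refl (δ (row j) r) ⟦ k ⟧ ⟩
      0ℚ
        ≤⟨ 0≤* (0≤δ (C (col j)) (R r)) (0≤size (suc r) j) ⟩
      δ (C (col j)) (R r) ℚ.* size (suc r) j ∎)
    where open ℚ.≤-Reasoning

  -- The column total is repeated for each of the `k` rows, matching the factor `k` in `rowCost`.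
  -- Each of the `k * l` jobs therefore contributes `k`, wherever it runs.
  totalCost : ∀ S → sum (λ r → rowCost r S ℚ.+ sum (λ c → colCost c S))
                  ≡ ⟦ k ⟧ ℚ.* ⟦ l ⟧ ℚ.* ⟦ k ⟧
  totalCost S = begin
    sum (λ r → rowCost r S ℚ.+ sum (λ c → colCost c S))
      ≡⟨ ∑-distrib-+ (λ r → rowCost r S) (λ _ → sum (λ c → colCost c S)) ⟩
    sum (λ r → rowCost r S) ℚ.+ sum {k} (λ _ → sum (λ c → colCost c S))
      ≡⟨ cong₂ ℚ._+_ (sum-δ-* row (λ j → ⟦ k ⟧ ℚ.* atRow S j))
           (trans (sum-const k _) (cong (⟦ k ⟧ ℚ.*_) (sum-δ-* col (λ j → 1ℚ ℚ.- atRow S j)))) ⟩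
    sum (λ j → ⟦ k ⟧ ℚ.* atRow S j) ℚ.+ ⟦ k ⟧ ℚ.* sum (λ j → 1ℚ ℚ.- atRow S j)
      ≡⟨ cong (sum (λ j → ⟦ k ⟧ ℚ.* atRow S j) ℚ.+_)
           (*-distribˡ-sum ⟦ k ⟧ (λ j → 1ℚ ℚ.- atRow S j)) ⟩
    sum (λ j → ⟦ k ⟧ ℚ.* atRow S j) ℚ.+ sum (λ j → ⟦ k ⟧ ℚ.* (1ℚ ℚ.- atRow S j))
      ≡⟨ ∑-distrib-+ (λ j → ⟦ k ⟧ ℚ.* atRow S j) (λ j → ⟦ k ⟧ ℚ.* (1ℚ ℚ.- atRow S j)) ⟨
    sum (λ j → ⟦ k ⟧ ℚ.* atRow S j ℚ.+ ⟦ k ⟧ ℚ.* (1ℚ ℚ.- atRow S j))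
      ≡⟨ sum-cong-≗ (λ j → solve 2 (λ κ x → κ :* x :+ κ :* (con 1ℚ :- x) := κ)
           refl ⟦ k ⟧ (atRow S j)) ⟩
    sum {k ℕ.* l} (const ⟦ k ⟧)
      ≡⟨ sum-const (k ℕ.* l) ⟦ k ⟧ ⟩
    ⟦ k ℕ.* l ⟧ ℚ.* ⟦ k ⟧
      ≡⟨ cong (ℚ._* ⟦ k ⟧) (⟦⟧-* k l) ⟩
    ⟦ k ⟧ ℚ.* ⟦ l ⟧ ℚ.* ⟦ k ⟧ ∎
    where open ≡-Reasoning

  -- The same total with each row cost replaced by its robustness bound `b * k` and each column cost
  -- by its consistency bound `a * l`.
  costBound : ℚ → ℚ → ℚ
  costBound a b = ⟦ k ⟧ ℚ.* (b ℚ.* ⟦ k ⟧ ℚ.+ ⟦ l ⟧ ℚ.* (a ℚ.* ⟦ l ⟧))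

  -- a and b stand for rational upper bounds of α and β.
  totalCost≤ : (𝓡 : RandomSchedule grid) (let open RandomSchedule 𝓡) → ∀ {a b} →
    0ℚ ℚ.< ⟦ k ⟧ ℚ.* ⟦ l ⟧ ℚ.* ⟦ k ⟧ →
    (∀ r → 𝔼 prob (rowCost r ∘ schedule) ≤ fromℚ (b ℚ.* ⟦ k ⟧)) →
    (∀ c → 𝔼 prob (colCost c ∘ schedule) ≤ fromℚ (a ℚ.* ⟦ l ⟧)) →
    ⟦ k ⟧ ℚ.* ⟦ l ⟧ ℚ.* ⟦ k ⟧ ℚ.≤ costBound a b
  totalCost≤ 𝓡 {a} {b} 0<n rows cols = subst (_ ℚ.≤_)
    (trans (sum-const k _) (cong (λ x → ⟦ k ⟧ ℚ.* (b ℚ.* ⟦ k ⟧ ℚ.+ x)) (sum-const l _)))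
    (fromℚ-cancel (≤-trans
      -- The total cost is the same in every outcome, so it is a lower bound for its own
      -- expectation.
      (𝔼-const prob total 0<n _ (totalCost ∘ schedule))
      (𝔼-sum-≤ prob (λ r ω → rowCost r (schedule ω) ℚ.+ sum (λ c → colCost c (schedule ω))) λ r →
        𝔼-+-≤ prob (rowCost r ∘ schedule) (λ ω → sum (λ c → colCost c (schedule ω))) (rows r)
          (𝔼-sum-≤ prob (λ c → colCost c ∘ schedule) cols))))
    where open RandomSchedule 𝓡

  -- After division by `k`: `b k + a l² < b k + a l² + 1 ≤ b k + k = (b + 1) k ≤ l k`.
  costBound< : ∀ {a b} → 0ℚ ℚ.< ⟦ k ⟧ → b ℚ.+ 1ℚ ℚ.≤ ⟦ l ⟧ → a ℚ.* (⟦ l ⟧ ℚ.* ⟦ l ⟧) ℚ.+ 1ℚ ℚ.≤ ⟦ k ⟧ →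
               costBound a b ℚ.< ⟦ k ⟧ ℚ.* ⟦ l ⟧ ℚ.* ⟦ k ⟧
  costBound< {a} {b} 0<k b+1≤l all+1≤k = begin-strict
    κ ℚ.* (b ℚ.* κ ℚ.+ ℓ ℚ.* (a ℚ.* ℓ))
      <⟨ ℚ.*-monoʳ-<-pos κ {{ℚ.positive 0<k}} (begin-strict
        b ℚ.* κ ℚ.+ ℓ ℚ.* (a ℚ.* ℓ)
          ≡⟨ solve 4 (λ a b κ l → b :* κ :+ l :* (a :* l) := b :* κ :+ a :* (l :* l) :+ con 0ℚ)
               refl a b κ ℓ ⟩
        b ℚ.* κ ℚ.+ a ℚ.* (ℓ ℚ.* ℓ) ℚ.+ 0ℚ
          <⟨ ℚ.+-monoʳ-< (b ℚ.* κ ℚ.+ a ℚ.* (ℓ ℚ.* ℓ)) CauchyClosure.0<1 ⟩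
        b ℚ.* κ ℚ.+ a ℚ.* (ℓ ℚ.* ℓ) ℚ.+ 1ℚ
          ≡⟨ ℚ.+-assoc (b ℚ.* κ) _ _ ⟩
        b ℚ.* κ ℚ.+ (a ℚ.* (ℓ ℚ.* ℓ) ℚ.+ 1ℚ)
          ≤⟨ ℚ.+-monoʳ-≤ (b ℚ.* κ) all+1≤k ⟩
        b ℚ.* κ ℚ.+ κ
          ≡⟨ solve 2 (λ b κ → b :* κ :+ κ := (b :+ con 1ℚ) :* κ) refl b κ ⟩
        (b ℚ.+ 1ℚ) ℚ.* κ
          ≤⟨ ℚ.*-monoʳ-≤-nonNeg κ {{ℚ.nonNegative (ℚ.<⇒≤ 0<k)}} b+1≤l ⟩
        ℓ ℚ.* κ ∎) ⟩
    κ ℚ.* (ℓ ℚ.* κ)      ≡⟨ ℚ.*-assoc κ ℓ κ ⟨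
    κ ℚ.* ℓ ℚ.* κ        ∎
    where
    open ℚ.≤-Reasoning
    κ ℓ : ℚ
    κ  = ⟦ k ⟧
    ℓ = ⟦ l ⟧

theorem12 : ∀ (α β : ℝ) → 1ℝ ≤ α → 1ℝ ≤ β →
    Σ[ I ∈ Instance ] Σ[ 𝓤 ∈ UncertaintySet I ]
    let U = UncertaintySet.U 𝓤 in
    Satisfiable U × Bounded I U ×
    (Σ[ q̂ ∈ Scenario I ] q̂ ∈ U ×
    (Σ[ optrob ∈ ℝ∞ ] IsOPTrob I U optrob ×
    ¬ (Σ[ R ∈ RandomSchedule I ] Consistent I α q̂ R × Robust I β U optrob R)))
theorem12 α β 1≤α 1≤β =
  let a , 0<a , α≤a = CauchyClosure.eventually-bounded (seq α) (cauchy α)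
      b , 0<b , β≤b = CauchyClosure.eventually-bounded (seq β) (cauchy β)
      -- The number of columns is fixed first, from `b`, because the number of rows has to exceed
      -- `a l²`.
      l , b+1≤l = archimedean (b ℚ.+ 1ℚ)
      k , all+1≤k = archimedean (a ℚ.* (⟦ l ⟧ ℚ.* ⟦ l ⟧) ℚ.+ 1ℚ)
      open Grid k l
      0<l = ℚ.<-≤-trans (ℚ.+-mono-< 0<b CauchyClosure.0<1) b+1≤l
      1≤k = ℚ.≤-trans
        (ℚ.+-mono-≤ (0≤* (ℚ.<⇒≤ 0<a) (0≤* (0≤⟦⟧ l) (0≤⟦⟧ l))) (ℚ.≤-refl {1ℚ})) all+1≤k
      0<k = ℚ.<-≤-trans CauchyClosure.0<1 1≤k
      ∈U = size∈dominated grid size 0≤size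
  in grid , dominated grid size , (fromℚ ∘ size zero , ∈U zero)
   , (fromℚ ⟦ k ⟧ , λ (_ , t , p≤) j → ≤-trans (p≤ j) (fromℚ-mono (size≤ 1≤k t j)))
   , fromℚ ∘ size zero , ∈U zero
   , OPTrob , (worst grid size , worst-isSup grid size 0≤size , ≈⁺-refl ≈-refl)
   , λ (𝓡 , consistent , robust) →
       let open RandomSchedule 𝓡 in
       ℚ.<-irrefl refl (ℚ.<-≤-trans (costBound< {a} {b} 0<k b+1≤l all+1≤k)
         (totalCost≤ 𝓡 {a} {b} (0<* (0<* 0<k 0<l) 0<k)
           -- The minorant `rowCost r` is tested against robustness in the scenario adverse to row
           -- `r`; below, `colCost c` is tested against consistency.
           (λ r → [≤]-injective (≤∞-trans
             (robust (∈U (suc r)) (fromℚ ∘ rowCost r ∘ schedule) (rowCost≤Cmax r ∘ schedule))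
             (·∞-upper β 1≤β 0<b β≤b (0≤⟦⟧ k) OPTrob-upper)))
           (λ c → [≤]-injective (≤∞-trans
             (consistent (fromℚ ∘ colCost c ∘ schedule) (colCost≤Cmax c ∘ schedule))
             (·∞-upper α 1≤α 0<a α≤a (0≤⟦⟧ l) OPT-nominal)))))
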